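{- Let $M$ be an $L$-structure and $\phi(x,y)$ an $L$-formula. Let $N\succeq M$ and let $q\in S_{\phi(x)}(N)$ be finitely satisfiable in $M$. Let $\epsilon>0$ and $\delta\geq0$. Suppose $\phi(x,y)$ is $\epsilon$-stable in $M$ and $\psi(y)$ is an $L$-formula with parameters from $M$ such that $\mathfrak d(\phi(q,b),\psi^M(b))\leq\delta$ for all $b\in M^y$. Then $\mathfrak d(\phi(q,b),\psi^N(b))\leq\delta+\epsilon$ for all $b\in N^y$.
   Context: Logic: We work in continuous (metric) first-order logic with values in $\mathfrak V=\ell^\infty(\omega)$ (real Banach space), with metric $\mathfrak d(\mathfrak r,\mathfrak s)=\|\mathfrak r-\mathfrak s\|_\infty$; an isometric copy $\mathbb R\hookrightarrow\mathfrak V$ is fixed. It is set up as standard $[0,1]$-valued continuous logic (complete metric structures, possibly many-sorted, symbols with prescribed moduli of uniform continuity), except that each predicate symbol $P$ of the language $L$ comes with a compact set $K_P\subseteq\mathfrak V$ in which it takes values; connectives are all continuous functions $u:\mathfrak V^n\to\mathfrak V$; and $\sup_x\psi$, $\inf_x\psi$ are formed only for formulas $\psi$ with value set $K_\psi\subseteq\mathbb R^{\geq0}$. Inductively each formula $\phi$ has a compact value set $K_\phi\subseteq\mathfrak V$ ($K_{u(\phi_0,\ldots,\phi_{n-1})}=u(\prod_i K_{\phi_i})$, and $K_{\sup_x\psi}=K_{\inf_x\psi}=K_\psi$), and $\phi^M$ takes values in $K_\phi$ in every $L$-structure $M$. Here $x,y$ are tuples of variables and $M^x$ is the product of sorts of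 $M$ corresponding to $x$. $N\succeq M$ means $N$ is an elementary extension of $M$. Types: $S_{\phi(x)}(N)$ is the set of complete $\phi(x)$-types over $N$. A type $q\in S_{\phi(x)}(N)$ is determined by the function $b\mapsto\phi(q,b)$ from $N^y$ to $K_\phi$, where $\phi(q,b)=\phi^{N'}(a,b)$ for any realization $a\in N'^x$ of $q$ in some $N'\succeq N$. Finite satisfiability: for $N\succeq M$, a type $q\in S_{\phi(x)}(N)$ is finitely satisfiable in $M$ if, for every $n<\omega$, $b_0,\ldots,b_{n-1}\in N^y$ and $\delta>0$, there is some $a\in M^x$ such that $\mathfrak d(\phi^N(a,b_i),\phi(q,b_i))<\delta$ for all $i<n$. Stability: $\phi(x,y)$ is $\epsilon$-stable in $M$ if there are no sequences $\langle a_i\rangle_{i<\omega}$ in $M^x$ and $\langle b_i\rangle_{i<\omega}$ in $M^y$ such that $\mathfrak d(\phi^M(a_i,b_j),\phi^M(a_j,b_i))\geq\epsilon$ for all $i<j<\omega$. -}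

module Defs where

open import Level using (Level; suc)
open import Axiom.ExcludedMiddle using (ExcludedMiddle)
open import Algebra.Bundles using (CommutativeRing)
open import Data.Fin.Base using (Fin)
open import Data.List.Base using (List; []; _∷_; _++_)
open import Data.List.Membership.Propositional using (_∈_)
open import Data.List.Relation.Unary.All as All using (All; []; _∷_)
open import Data.List.Relation.Unary.All.Properties using (++⁺)
open import Data.List.Relation.Unary.Any using (Any)
open import Data.Nat.Base as ℕ using (ℕ)
open import Data.Product.Base using (Σ-syntax; ∃; ∃-syntax; _×_; proj₁)
open import Data.Sum.Base using ([_,_]′)
open import Relation.Binary.Core using (Rel)
open import Relation.Binary.Definitions using (_Respects_)
open import Relation.Binary.Structures using (IsTotalOrder)
import Relation.Binary.Construct.NonStrictToStrict as NonStrictToStrict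
open import Relation.Nullary.Decidable.Core using (yes; no)
open import Relation.Nullary.Negation.Core using (¬_)
open import Relation.Unary using (Pred; _⊆_; Satisfiable)

module Extrema {ℓ} {A : Set ℓ} (_≤_ : Rel A ℓ) where
  UpperBound LowerBound IsSup IsInf : Pred A ℓ → A → Set ℓ
  UpperBound S b = ∀ r → S r → r ≤ b
  LowerBound S b = ∀ r → S r → b ≤ r
  IsSup S s = UpperBound S s × (∀ b → UpperBound S b → s ≤ b)
  IsInf S s = LowerBound S s × (∀ b → LowerBound S b → b ≤ s)

-- The real numbers, axiomatised up to isomorphism as a Dedekind-complete
-- ordered field over a setoid.
record CompleteOrderedField (ℓ : Level) : Set (suc ℓ) where
  field
    commutativeRing : CommutativeRing ℓ ℓ

  open CommutativeRing commutativeRing public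
    using (_≈_; _+_; _*_; _-_; -_; 0#; 1#) renaming (Carrier to ℝ)

  field
    _≤_          : Rel ℝ ℓ
    isTotalOrder : IsTotalOrder _≈_ _≤_
    0≉1          : ¬ (0# ≈ 1#)
    inverse      : ∀ r → ¬ (r ≈ 0#) → ∃[ s ] (r * s) ≈ 1#
    +-mono-≤     : ∀ r {s t} → s ≤ t → (r + s) ≤ (r + t)
    *-nonneg     : ∀ {r s} → 0# ≤ r → 0# ≤ s → 0# ≤ (r * s)

  open NonStrictToStrict _≈_ _≤_ public using (_<_)

  open Extrema _≤_ public

  field
    complete : ∀ (S : Pred ℝ ℓ) → Satisfiable S → ∃ (UpperBound S) → ∃ (IsSup S)

  ∣_∣ : ℝ → ℝ
  ∣ r ∣ = [ (λ _ → r) , (λ _ → - r) ]′ (IsTotalOrder.total isTotalOrder 0# r)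

-- The mathematics is classical: excluded middle is an explicit parameter.
module Values {ℓ} (em : ExcludedMiddle ℓ) (R : CompleteOrderedField ℓ) where
  open CompleteOrderedField R

  -- The value 0# is only a convention for sets without a supremum (infimum).
  -- It plays no role below: 𝔡 is taken between bounded sequences, and in eval the
  -- sorts are nonempty and the values of a formula ψ lie in the compact set K ψ.
  sup inf : Pred ℝ ℓ → ℝ
  sup S with em {∃ (IsSup S)}
  ... | yes p = proj₁ p
  ... | no  _ = 0#
  inf S with em {∃ (IsInf S)}
  ... | yes p = proj₁ p
  ... | no  _ = 0#

  -- ℓ^∞(ω)
  record 𝔙 : Set ℓ where
    field
      seq     : ℕ → ℝ
      bounded : ∃[ B ] ∀ n → ∣ seq n ∣ ≤ B
  open 𝔙 public

  infix 4 _≈ᵥ_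
  _≈ᵥ_ : Rel 𝔙 ℓ
  v ≈ᵥ w = ∀ n → seq v n ≈ seq w n

  𝔡 : 𝔙 → 𝔙 → ℝ
  𝔡 v w = sup (λ r → ∃[ n ] r ≈ ∣ seq v n - seq w n ∣)

  IsOpen : Pred 𝔙 ℓ → Set ℓ
  IsOpen U = ∀ v → U v → ∃[ ε ] 0# < ε × (∀ w → 𝔡 v w < ε → U w)

  Compact : Pred 𝔙 ℓ → Set (suc ℓ)
  Compact K = ∀ {I : Set ℓ} (U : I → Pred 𝔙 ℓ) → (∀ i → IsOpen (U i)) →
              (∀ v → K v → ∃[ i ] U i v) →
              Σ[ is ∈ List I ] ∀ v → K v → Any (λ i → U i v) is

  -- 𝔙ⁿ carries the maximum metric.
  Continuous : ∀ {n} → ((Fin n → 𝔙) → 𝔙) → Set ℓ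
  Continuous u = ∀ v ε → 0# < ε →
    ∃[ δ ] 0# < δ × (∀ w → (∀ i → 𝔡 (v i) (w i) < δ) → 𝔡 (u v) (u w) ≤ ε)

  record IsometricCopy : Set ℓ where
    field
      ι        : ℝ → 𝔙
      isometry : ∀ r s → 𝔡 (ι r) (ι s) ≈ ∣ r - s ∣

  record Modulus : Set ℓ where
    field
      Δ        : ℝ → ℝ
      Δ-cong   : ∀ {ε ε′} → ε ≈ ε′ → Δ ε ≈ Δ ε′
      positive : ∀ {ε} → 0# < ε → 0# < Δ ε

  record CompleteMetricSpace : Set (suc ℓ) where
    field
      Carrier  : Set ℓ
      _≈ₘ_     : Rel Carrier ℓ
      dist     : Carrier → Carrier → ℝ
      nonneg   : ∀ a b → 0# ≤ dist a b
      ≈⇒dist≈0 : ∀ {a b} → a ≈ₘ b → dist a b ≈ 0#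
      dist≈0⇒≈ : ∀ {a b} → dist a b ≈ 0# → a ≈ₘ b
      self     : ∀ a → dist a a ≈ 0#
      symm     : ∀ a b → dist a b ≈ dist b a
      triangle : ∀ a b c → dist a c ≤ (dist a b + dist b c)
      diam≤1   : ∀ a b → dist a b ≤ 1#
      point    : Carrier
      limits   : ∀ (a : ℕ → Carrier) →
        (∀ ε → 0# < ε → ∃[ k ] ∀ m n → k ℕ.≤ m → k ℕ.≤ n → dist (a m) (a n) < ε) →
        ∃[ l ] ∀ ε → 0# < ε → ∃[ k ] ∀ n → k ℕ.≤ n → dist (a n) l < ε

module Logic {ℓ} (em : ExcludedMiddle ℓ) (R : CompleteOrderedField ℓ)
             (copy : Values.IsometricCopy em R) where
  open CompleteOrderedField R
  open Values em R
  open IsometricCopy copy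

  record Language : Set (suc ℓ) where
    field
      Sort     : Set ℓ
      Func     : Set ℓ
      dom      : Func → List Sort
      cod      : Func → Sort
      modF     : Func → Modulus
      Predicate : Set ℓ
      arity    : Predicate → List Sort
      modP     : Predicate → Modulus
      KP       : Predicate → Pred 𝔙 ℓ
      KP-resp  : ∀ P → KP P Respects _≈ᵥ_
      KP-compact : ∀ P → Compact (KP P)

  module _ (L : Language) where
    open Language L

    -- Variables are de Bruijn indices into the list of sorts of the context.
    data Term (Γ : List Sort) : Sort → Set ℓ where
      var : ∀ {s} → s ∈ Γ → Term Γ s
      app : ∀ F → All (Term Γ) (dom F) → Term Γ (cod F)

    Nonnegative : Pred 𝔙 ℓ
    Nonnegative v = ∃[ r ] 0# ≤ r × v ≈ᵥ ι r

    data Formula : List Sort → Set ℓ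
    K : ∀ {Γ} → Formula Γ → Pred 𝔙 ℓ

    -- The metric is a logical symbol, with values in the copy of [0,1].
    data Formula where
      pred  : ∀ {Γ} P → All (Term Γ) (arity P) → Formula Γ
      metr  : ∀ {Γ s} → Term Γ s → Term Γ s → Formula Γ
      conn  : ∀ {Γ n} (u : (Fin n → 𝔙) → 𝔙) → Continuous u →
              (Fin n → Formula Γ) → Formula Γ
      sup′  : ∀ {Γ} s (ψ : Formula (s ∷ Γ)) → K ψ ⊆ Nonnegative → Formula Γ
      inf′  : ∀ {Γ} s (ψ : Formula (s ∷ Γ)) → K ψ ⊆ Nonnegative → Formula Γ

    K (pred P _)   = KP P
    K (metr _ _)   = λ v → ∃[ r ] 0# ≤ r × r ≤ 1# × v ≈ᵥ ι r
    K (conn u _ φ) = λ v → ∃[ w ] (∀ i → K (φ i) (w i)) × v ≈ᵥ u w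
    K (sup′ _ ψ _) = K ψ
    K (inf′ _ ψ _) = K ψ

    record Structure : Set (suc ℓ) where
      field
        sort : Sort → CompleteMetricSpace

      ∥_∥ : Sort → Set ℓ
      ∥ s ∥ = CompleteMetricSpace.Carrier (sort s)

      distance : ∀ {s} → ∥ s ∥ → ∥ s ∥ → ℝ
      distance {s} = CompleteMetricSpace.dist (sort s)

      -- a, b are at distance < δ in the maximum metric of the product
      Close : ∀ {Γ} → All ∥_∥ Γ → All ∥_∥ Γ → ℝ → Set ℓ
      Close {Γ} a b δ = ∀ {s} (i : s ∈ Γ) → distance (All.lookup a i) (All.lookup b i) < δ

      field
        func    : ∀ F → All ∥_∥ (dom F) → ∥ cod F ∥
        func-uc : ∀ F {ε} → 0# < ε → ∀ a b → Close a b (Modulus.Δ (modF F) ε) →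
                  distance (func F a) (func F b) ≤ ε
        rel     : ∀ P → All ∥_∥ (arity P) → 𝔙
        rel-K   : ∀ P a → KP P (rel P a)
        rel-uc  : ∀ P {ε} → 0# < ε → ∀ a b → Close a b (Modulus.Δ (modP P) ε) →
                  𝔡 (rel P a) (rel P b) ≤ ε

    infix 8 _^_
    _^_ : Structure → List Sort → Set ℓ
    M ^ x = All (Structure.∥_∥ M) x

    module _ (M : Structure) where
      open Structure M

      ⟦_⟧ₜ : ∀ {Γ s} → Term Γ s → M ^ Γ → ∥ s ∥
      ⟦_⟧ₛ : ∀ {Γ x} → All (Term Γ) x → M ^ Γ → M ^ x
      ⟦ var i ⟧ₜ    a = All.lookup a i
      ⟦ app F ts ⟧ₜ a = func F (⟦ ts ⟧ₛ a)
      ⟦ [] ⟧ₛ       a = []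
      ⟦ t ∷ ts ⟧ₛ   a = ⟦ t ⟧ₜ a ∷ ⟦ ts ⟧ₛ a

      -- For sup′ and inf′ the values of ψ lie in the compact set K ψ, which is
      -- contained in the copy of ℝ≥0, and the extremum is taken in ℝ≥0.
      eval : ∀ {Γ} → Formula Γ → M ^ Γ → 𝔙
      eval (pred P ts)  a = rel P (⟦ ts ⟧ₛ a)
      eval (metr t t′)  a = ι (distance (⟦ t ⟧ₜ a) (⟦ t′ ⟧ₜ a))
      eval (conn u _ φ) a = u (λ i → eval (φ i) a)
      eval (sup′ s ψ _) a = ι (sup (λ r → Σ[ c ∈ ∥ s ∥ ] ι r ≈ᵥ eval ψ (c ∷ a)))
      eval (inf′ s ψ _) a = ι (inf (λ r → Σ[ c ∈ ∥ s ∥ ] ι r ≈ᵥ eval ψ (c ∷ a)))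

    eval₂ : ∀ (M : Structure) {x y} → Formula (x ++ y) → M ^ x → M ^ y → 𝔙
    eval₂ M φ a b = eval M φ (++⁺ a b)

    -- The inclusion of M in N is represented by an elementary embedding.
    infix 4 _⪰_
    record _⪰_ (N M : Structure) : Set ℓ where
      field
        emb        : ∀ {s} → Structure.∥_∥ M s → Structure.∥_∥ N s
        elementary : ∀ {Γ} (φ : Formula Γ) (a : M ^ Γ) →
                     eval M φ a ≈ᵥ eval N φ (All.map emb a)

      incl : ∀ {x} → M ^ x → N ^ x
      incl = All.map emb

    -- S_φ(x)(N): a type is the function b ↦ φ(q,b), which must be induced by
    -- some tuple in some elementary extension of N.
    record TypeOver (N : Structure) {x y} (φ : Formula (x ++ y)) : Set (suc ℓ) where
      field
        value    : N ^ y → 𝔙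
        realised : Σ[ N′ ∈ Structure ] Σ[ ext ∈ N′ ⪰ N ] Σ[ a ∈ N′ ^ x ]
                   ∀ b → value b ≈ᵥ eval₂ N′ φ a (_⪰_.incl ext b)

    FinitelySatisfiable : ∀ {M N : Structure} → N ⪰ M → ∀ {x y} (φ : Formula (x ++ y)) →
                          TypeOver N {x} {y} φ → Set ℓ
    FinitelySatisfiable {M} {N} ext {x} {y} φ q =
      ∀ n (b : Fin n → N ^ y) δ → 0# < δ →
      Σ[ a ∈ M ^ x ] ∀ i → 𝔡 (eval₂ N φ (_⪰_.incl ext a) (b i)) (TypeOver.value q (b i)) < δ

    Stable : ℝ → (M : Structure) → ∀ {x y} → Formula (x ++ y) → Set ℓ
    Stable ε M {x} {y} φ =
      ¬ (Σ[ a ∈ (ℕ → M ^ x) ] Σ[ b ∈ (ℕ → M ^ y) ]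
         ∀ i j → i ℕ.< j → ε ≤ 𝔡 (eval₂ M φ (a i) (b j)) (eval₂ M φ (a j) (b i)))

{-# OPTIONS --safe #-}
module Submission where

-- Suppose the distance of φ(q,b*) and ψ(b*) exceeds δ + ε + 4η for some b* in N. Choose inductively
-- aₙ and bₙ in M: by finite satisfiability, φ(aₙ,b) is η-close to φ(q,b) for b = b* and b = bⱼ, j < n;
-- by elementarity, φ(aⱼ,bₙ) is η-close to φ(aⱼ,b*) for j < n, and ψ(bₙ) to ψ(b*). For i < j then
-- φ(q,b*) ~ φ(aᵢ,b*) ~ φ(aᵢ,bⱼ) and φ(aⱼ,bᵢ) ~ φ(q,bᵢ) ~ ψ(bᵢ) ~ ψ(b*), where the step
-- φ(q,bᵢ) ~ ψ(bᵢ) costs δ and each of the others η, so φ(aᵢ,bⱼ) and φ(aⱼ,bᵢ) are at distance at least ε,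
-- contradicting stability.

open import Defs
open import Axiom.ExcludedMiddle using (ExcludedMiddle)
open import Algebra.Bundles using (CommutativeRing)
import Algebra.Properties.AbelianGroup as AbelianGroupProperties
import Algebra.Properties.Ring as RingProperties
import Algebra.Solver.CommutativeMonoid as CommutativeMonoidSolver
open import Data.Fin.Base using (Fin; zero; suc)
open import Data.List.Base using (List; []; _∷_; _++_; length; tabulate)
import Data.List.Base as List
import Data.List.Extrema as ListExtrema
open import Data.List.Membership.Propositional using (_∈_)
open import Data.List.Relation.Unary.All as All using (All; []; _∷_)
open import Data.List.Relation.Unary.All.Properties
  using (++⁺; tabulate⁺; tabulate⁻; map-∘; map-cong; lookup-map)
open import Data.List.Relation.Unary.Any as Any using (here; there)
open import Data.List.Relation.Unary.Any.Properties using (lookup-index)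
open import Data.Nat.Base as ℕ using (ℕ; zero; suc)
open import Data.Nat.Properties using (≤⇒≤′)
open import Data.Product.Base using (Σ-syntax; ∃; ∃-syntax; _×_; _,_; proj₁; proj₂)
open import Data.Sum.Base using (inj₁; inj₂)
open import Function.Base using (_∘_)
open import Relation.Binary.Bundles using (TotalOrder)
open import Relation.Binary.PropositionalEquality.Core as ≡ using (_≡_)
import Relation.Binary.Construct.NonStrictToStrict as NonStrictToStrict
import Relation.Binary.Reasoning.PartialOrder as PartialOrderReasoning
open import Relation.Nullary.Decidable.Core using (yes; no; decidable-stable)
open import Relation.Nullary.Negation.Core using (¬_; contradiction)
open import Relation.Unary using (Pred; _⊆_; Satisfiable)

-- Arithmetic of ordered fields and absolute values.

module OrderedFieldProperties {ℓ} (R : CompleteOrderedField ℓ) where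
  open CompleteOrderedField R renaming (_≤_ to infix 4 _≤_)
  open CommutativeRing commutativeRing public
    using ( refl; sym; trans; +-cong; +-congˡ; +-congʳ; +-comm; +-assoc; +-identityˡ
          ; +-identityʳ; -‿inverseʳ; *-congʳ; *-identityˡ; distribʳ
          ; ring; +-abelianGroup; +-commutativeMonoid)
  open AbelianGroupProperties +-abelianGroup public using (⁻¹-anti-homo‿-; xyx⁻¹≈y; ε⁻¹≈ε)
  open RingProperties ring public using (-‿distribˡ-*; -‿involutive)

  totalOrder : TotalOrder ℓ ℓ ℓ
  totalOrder = record { isTotalOrder = isTotalOrder }

  open TotalOrder totalOrder public using (poset; antisym; total)
    renaming (refl to ≤-refl; reflexive to ≤-reflexive; trans to ≤-trans)

  open NonStrictToStrict _≈_ _≤_ public using (<⇒≤)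

  <⇒≱ : ∀ {r s} → r < s → ¬ (s ≤ r)
  <⇒≱ = NonStrictToStrict.<⇒≱ _≈_ _≤_ antisym

  ≰⇒> : ∀ {r s} → ¬ (r ≤ s) → s < r
  ≰⇒> = NonStrictToStrict.≰⇒> _≈_ _≤_ sym ≤-reflexive total

  open PartialOrderReasoning poset public

  +-monoʳ : ∀ {r s} t → r ≤ s → (r + t) ≤ (s + t)
  +-monoʳ {r} {s} t r≤s = begin
    r + t ≈⟨ +-comm r t ⟩
    t + r ≤⟨ +-mono-≤ t r≤s ⟩
    t + s ≈⟨ +-comm t s ⟩
    s + t ∎

  +-mono₂ : ∀ {r s t u} → r ≤ s → t ≤ u → (r + t) ≤ (s + u)
  +-mono₂ {s = s} {t} r≤s t≤u = ≤-trans (+-monoʳ t r≤s) (+-mono-≤ s t≤u)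

  r≤r+s : ∀ r {s} → 0# ≤ s → r ≤ (r + s)
  r≤r+s r 0≤s = ≤-trans (≤-reflexive (sym (+-identityʳ r))) (+-mono-≤ r 0≤s)

  s+[r-s]≈r : ∀ r s → (s + (r - s)) ≈ r
  s+[r-s]≈r r s = trans (sym (+-assoc s r (- s))) (xyx⁻¹≈y s r)

  r-s≤t⇒r≤s+t : ∀ {r s t} → (r - s) ≤ t → r ≤ (s + t)
  r-s≤t⇒r≤s+t {r} {s} p = ≤-trans (≤-reflexive (sym (s+[r-s]≈r r s))) (+-mono-≤ s p)

  r≤s+t⇒r-s≤t : ∀ {r s t} → r ≤ (s + t) → (r - s) ≤ t
  r≤s+t⇒r-s≤t {r} {s} {t} p = begin
    r - s       ≤⟨ +-monoʳ (- s) p ⟩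
    s + t - s   ≈⟨ xyx⁻¹≈y s t ⟩
    t           ∎

  r≤s⇒0≤s-r : ∀ {r s} → r ≤ s → 0# ≤ (s - r)
  r≤s⇒0≤s-r {r} {s} r≤s = ≤-trans (≤-reflexive (sym (-‿inverseʳ r))) (+-monoʳ (- r) r≤s)

  r<s⇒0<s-r : ∀ {r s} → r < s → 0# < (s - r)
  r<s⇒0<s-r {r} {s} r<s = ≰⇒> λ s-r≤0 →
    <⇒≱ r<s (≤-trans (r-s≤t⇒r≤s+t s-r≤0) (≤-reflexive (+-identityʳ r)))

  neg-antimono : ∀ {r s} → r ≤ s → (- s) ≤ (- r)
  neg-antimono {r} {s} r≤s = begin
    - s           ≈⟨ +-identityʳ (- s) ⟨
    - s + 0#      ≤⟨ +-mono-≤ (- s) (r≤s⇒0≤s-r r≤s) ⟩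
    - s + (s - r) ≈⟨ +-assoc (- s) s (- r) ⟨
    - s + s - r   ≈⟨ +-congʳ (trans (+-comm (- s) s) (-‿inverseʳ s)) ⟩
    0# - r        ≈⟨ +-identityˡ (- r) ⟩
    - r           ∎

  0≤1 : 0# ≤ 1#
  0≤1 with total 0# 1#
  ... | inj₁ 0≤1 = 0≤1
  -- Here `- 1#` is nonnegative, hence so is its square, which is `1#`.
  ... | inj₂ 1≤0 = begin
    0#            ≤⟨ *-nonneg 0≤-1 0≤-1 ⟩
    - 1# * - 1#   ≈⟨ -‿distribˡ-* 1# (- 1#) ⟨
    - (1# * - 1#) ≈⟨ neg-cong (*-identityˡ (- 1#)) ⟩
    - (- 1#)      ≈⟨ -‿involutive 1# ⟩
    1#            ∎
    where
    open CommutativeRing commutativeRing using () renaming (-‿cong to neg-cong)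
    0≤-1 : 0# ≤ (- 1#)
    0≤-1 = ≤-trans (≤-reflexive (sym ε⁻¹≈ε)) (neg-antimono 1≤0)

  -- The left side is the length of the path in `chain`, term by term in the order of its steps; the
  -- right side collects the four errors `η`.
  six-term-sum : ∀ η ε δ → (η + (η + (ε + (η + (δ + η))))) ≈ ((δ + ε) + ((η + η) + (η + η)))
  six-term-sum = solve 3 (λ η ε δ →
    η ⊕ (η ⊕ (ε ⊕ (η ⊕ (δ ⊕ η)))) ⊜ (δ ⊕ ε) ⊕ ((η ⊕ η) ⊕ (η ⊕ η))) refl
    where open CommutativeMonoidSolver +-commutativeMonoid using (solve; _⊜_; _⊕_)

  private
    2# : ℝ
    2# = 1# + 1#

    1≤2 : 1# ≤ 2#
    1≤2 = r≤r+s 1# 0≤1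

    2≉0 : ¬ (2# ≈ 0#)
    2≉0 2≈0 = 0≉1 (antisym 0≤1 (≤-trans 1≤2 (≤-reflexive 2≈0)))

    2*r≈r+r : ∀ r → (2# * r) ≈ (r + r)
    2*r≈r+r r = trans (distribʳ r 1# 1#) (+-cong (*-identityˡ r) (*-identityˡ r))

  halve : ∀ r → 0# < r → ∃[ s ] 0# < s × (s + s) ≈ r
  halve r 0<r = s , (0≤s , λ 0≈s → proj₂ 0<r (trans (sym (+-identityʳ 0#))
                      (trans (+-cong 0≈s 0≈s) s+s≈r))) , s+s≈r
    where
    ½ : ℝ
    ½ = proj₁ (inverse 2# 2≉0)
    s : ℝ
    s = ½ * r
    s+s≈r : (s + s) ≈ r
    s+s≈r = begin-equality
      s + s           ≈⟨ distribʳ r ½ ½ ⟨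
      (½ + ½) * r     ≈⟨ *-congʳ (2*r≈r+r ½) ⟨
      2# * ½ * r      ≈⟨ *-congʳ (proj₂ (inverse 2# 2≉0)) ⟩
      1# * r          ≈⟨ *-identityˡ r ⟩
      r               ∎
    0≤s : 0# ≤ s
    0≤s with total 0# s
    ... | inj₁ 0≤s = 0≤s
    ... | inj₂ s≤0 = contradiction
      (≤-trans (≤-reflexive (sym s+s≈r)) (≤-trans (+-mono₂ s≤0 s≤0) (≤-reflexive (+-identityʳ 0#))))
      (<⇒≱ 0<r)

  r≤∣r∣ : ∀ r → r ≤ ∣ r ∣
  r≤∣r∣ r with total 0# r
  ... | inj₁ 0≤r = ≤-refl
  ... | inj₂ r≤0 = ≤-trans r≤0 (≤-trans (≤-reflexive (sym ε⁻¹≈ε)) (neg-antimono r≤0))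

  -r≤∣r∣ : ∀ r → (- r) ≤ ∣ r ∣
  -r≤∣r∣ r with total 0# r
  ... | inj₁ 0≤r = ≤-trans (neg-antimono 0≤r) (≤-trans (≤-reflexive ε⁻¹≈ε) 0≤r)
  ... | inj₂ r≤0 = ≤-refl

  ∣r∣≤s : ∀ {r s} → r ≤ s → (- r) ≤ s → ∣ r ∣ ≤ s
  ∣r∣≤s {r} r≤s -r≤s with total 0# r
  ... | inj₁ _ = r≤s
  ... | inj₂ _ = -r≤s

  ∣r-s∣≤t : ∀ {r s t} → r ≤ (s + t) → s ≤ (r + t) → ∣ r - s ∣ ≤ t
  ∣r-s∣≤t {r} {s} p q = ∣r∣≤s (r≤s+t⇒r-s≤t p)
    (≤-trans (≤-reflexive (⁻¹-anti-homo‿- r s)) (r≤s+t⇒r-s≤t q))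

  ∣r-s∣≤t⇒r≤s+t : ∀ {r s t} → ∣ r - s ∣ ≤ t → r ≤ (s + t)
  ∣r-s∣≤t⇒r≤s+t {r} {s} p = r-s≤t⇒r≤s+t (≤-trans (r≤∣r∣ (r - s)) p)

  ∣r-s∣≤t⇒s≤r+t : ∀ {r s t} → ∣ r - s ∣ ≤ t → s ≤ (r + t)
  ∣r-s∣≤t⇒s≤r+t {r} {s} p = r-s≤t⇒r≤s+t
    (≤-trans (≤-reflexive (sym (⁻¹-anti-homo‿- r s))) (≤-trans (-r≤∣r∣ (r - s)) p))

-- Suprema, infima and the metric of ℓ^∞(ω).

module ValuesProperties {ℓ} (em : ExcludedMiddle ℓ) (R : CompleteOrderedField ℓ) where
  open CompleteOrderedField R renaming (_≤_ to infix 4 _≤_)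
  open Values em R
  open OrderedFieldProperties R

  ≤-stable : ∀ {r s} → ¬ (s < r) → r ≤ s
  ≤-stable s≮r = decidable-stable em (λ r≰s → s≮r (≰⇒> r≰s))

  -- If `s < r`, the hypothesis at half the gap, `t`, gives `t + t ≤ t`, which contradicts `0# < t`.
  ≤-approx : ∀ {r s} → (∀ t → 0# < t → r ≤ (s + t)) → r ≤ s
  ≤-approx {r} {s} h = ≤-stable λ s<r →
    let t , 0<t , t+t≈r-s = halve (r - s) (r<s⇒0<s-r s<r)
        t+t≤t : (t + t) ≤ t
        t+t≤t = ≤-trans (≤-reflexive t+t≈r-s) (r≤s+t⇒r-s≤t (h t 0<t))
    in <⇒≱ 0<t (begin
      t         ≈⟨ xyx⁻¹≈y t t ⟨
      t + t - t ≤⟨ +-monoʳ (- t) t+t≤t ⟩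
      t - t     ≈⟨ -‿inverseʳ t ⟩
      0#        ∎)

  sup-isSup : ∀ {S} → ∃ (IsSup S) → IsSup S (sup S)
  sup-isSup {S} ∃sup with em {∃ (IsSup S)}
  ... | yes p = proj₂ p
  ... | no ¬p = contradiction ∃sup ¬p

  inf-isInf : ∀ {S} → ∃ (IsInf S) → IsInf S (inf S)
  inf-isInf {S} ∃inf with em {∃ (IsInf S)}
  ... | yes p = proj₂ p
  ... | no ¬p = contradiction ∃inf ¬p

  isSup-mono : ∀ {S T s t} → S ⊆ T → IsSup S s → IsSup T t → s ≤ t
  isSup-mono S⊆T (_ , least) (ub , _) = least _ λ r r∈S → ub r (S⊆T r∈S)

  isInf-mono : ∀ {S T s t} → S ⊆ T → IsInf S s → IsInf T t → t ≤ s
  isInf-mono S⊆T (_ , greatest) (lb , _) = greatest _ λ r r∈S → lb r (S⊆T r∈S)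

  isSup-resp : ∀ {S T : Pred ℝ ℓ} → S ⊆ T → T ⊆ S → ∃ (IsSup S) → ∃ (IsSup T)
  isSup-resp S⊆T T⊆S (s , ub , least) =
    s , (λ r r∈T → ub r (T⊆S r∈T)) , λ b b-ub → least b λ r r∈S → b-ub r (S⊆T r∈S)

  isInf-resp : ∀ {S T : Pred ℝ ℓ} → S ⊆ T → T ⊆ S → ∃ (IsInf S) → ∃ (IsInf T)
  isInf-resp S⊆T T⊆S (s , lb , greatest) =
    s , (λ r r∈T → lb r (T⊆S r∈T)) , λ b b-lb → greatest b λ r r∈S → b-lb r (S⊆T r∈S)

  -- Existence of the suprema is not presupposed: sets with the same elements have the same upper
  -- bounds, so either both have a supremum or both take the default value.
  sup-cong : ∀ {S T : Pred ℝ ℓ} → S ⊆ T → T ⊆ S → sup S ≈ sup T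
  sup-cong {S} {T} S⊆T T⊆S with em {∃ (IsSup S)} | em {∃ (IsSup T)}
  ... | yes (s , p) | yes (t , q) = antisym (isSup-mono S⊆T p q) (isSup-mono T⊆S q p)
  ... | yes p       | no ¬q       = contradiction (isSup-resp S⊆T T⊆S p) ¬q
  ... | no ¬p       | yes q       = contradiction (isSup-resp T⊆S S⊆T q) ¬p
  ... | no _        | no _        = refl

  inf-cong : ∀ {S T : Pred ℝ ℓ} → S ⊆ T → T ⊆ S → inf S ≈ inf T
  inf-cong {S} {T} S⊆T T⊆S with em {∃ (IsInf S)} | em {∃ (IsInf T)}
  ... | yes (s , p) | yes (t , q) = antisym (isInf-mono T⊆S q p) (isInf-mono S⊆T p q)
  ... | yes p       | no ¬q       = contradiction (isInf-resp S⊆T T⊆S p) ¬q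
  ... | no ¬p       | yes q       = contradiction (isInf-resp T⊆S S⊆T q) ¬p
  ... | no _        | no _        = refl

  -- Completeness speaks of suprema. The infimum is the supremum of the lower bounds, a set that
  -- every element of `S` bounds from above.
  infimum : ∀ S → Satisfiable S → ∃ (LowerBound S) → IsInf S (inf S)
  infimum S (r , r∈S) ∃lb = inf-isInf (i , (λ s s∈S → least s λ b b-lb → b-lb s s∈S) , ub)
    where
    supremum : ∃ (IsSup (LowerBound S))
    supremum = complete (LowerBound S) ∃lb (r , λ b b-lb → b-lb r r∈S)
    i = proj₁ supremum
    ub = proj₁ (proj₂ supremum)
    least = proj₂ (proj₂ supremum)

  -- Otherwise `e` would be a lower bound greater than the infimum.
  infimum-approached : ∀ {S i e} → IsInf S i → i < e → ∃[ r ] S r × r < e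
  infimum-approached (_ , greatest) i<e = decidable-stable em λ ∄r →
    <⇒≱ i<e (greatest _ λ r r∈S → ≤-stable λ r<e → ∄r (r , r∈S , r<e))

  -- Equivalent to `𝔡 v w ≤ e`, but free of suprema and absolute values, so that symmetry and the
  -- triangle inequality reduce to additions at each coordinate.
  record Within (e : ℝ) (v w : 𝔙) : Set ℓ where
    constructor pointwise
    field bounds : ∀ n → seq v n ≤ (seq w n + e) × seq w n ≤ (seq v n + e)

  -- The set is nonempty and bounded by the sum of the bounds of the two sequences, so `sup` does
  -- not fall back on its default here.
  𝔡-isSup : ∀ v w → IsSup (λ r → ∃[ n ] r ≈ ∣ seq v n - seq w n ∣) (𝔡 v w)
  𝔡-isSup v w = sup-isSup (complete _ (_ , 0 , refl) (B + C , λ r (n , r≈) →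
    ≤-trans (≤-reflexive r≈) (∣r∣≤s (differ v w n)
      (≤-trans (≤-reflexive (⁻¹-anti-homo‿- (seq v n) (seq w n)))
        (≤-trans (differ w v n) (≤-reflexive (+-comm C B)))))))
    where
    B = proj₁ (bounded v)
    C = proj₁ (bounded w)
    differ : ∀ v w n → (seq v n - seq w n) ≤ (proj₁ (bounded v) + proj₁ (bounded w))
    differ v w n = +-mono₂ (≤-trans (r≤∣r∣ (seq v n)) (proj₂ (bounded v) n))
                           (≤-trans (-r≤∣r∣ (seq w n)) (proj₂ (bounded w) n))

  within⇒𝔡≤ : ∀ {e v w} → Within e v w → 𝔡 v w ≤ e
  within⇒𝔡≤ {e} {v} {w} (pointwise h) = proj₂ (𝔡-isSup v w) e λ r (n , r≈) →
    ≤-trans (≤-reflexive r≈) (∣r-s∣≤t (proj₁ (h n)) (proj₂ (h n)))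

  𝔡≤⇒within : ∀ {e v w} → 𝔡 v w ≤ e → Within e v w
  𝔡≤⇒within {e} {v} {w} 𝔡≤e = pointwise λ n → ∣r-s∣≤t⇒r≤s+t (≤e n) , ∣r-s∣≤t⇒s≤r+t (≤e n)
    where
    ≤e : ∀ n → ∣ seq v n - seq w n ∣ ≤ e
    ≤e n = ≤-trans (proj₁ (𝔡-isSup v w) _ (n , refl)) 𝔡≤e

  within-sym : ∀ {e v w} → Within e v w → Within e w v
  within-sym (pointwise h) = pointwise λ n → proj₂ (h n) , proj₁ (h n)

  within-trans : ∀ {d e u v w} → Within d u v → Within e v w → Within (d + e) u w
  within-trans {d} {e} {u} {v} {w} (pointwise h) (pointwise k) = pointwise λ n →
    (begin
      seq u n           ≤⟨ proj₁ (h n) ⟩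
      seq v n + d       ≤⟨ +-monoʳ d (proj₁ (k n)) ⟩
      seq w n + e + d   ≈⟨ +-assoc (seq w n) e d ⟩
      seq w n + (e + d) ≈⟨ +-congˡ (+-comm e d) ⟩
      seq w n + (d + e) ∎) ,
    (begin
      seq w n           ≤⟨ proj₂ (k n) ⟩
      seq v n + e       ≤⟨ +-monoʳ e (proj₂ (h n)) ⟩
      seq u n + d + e   ≈⟨ +-assoc (seq u n) d e ⟩
      seq u n + (d + e) ∎)

  ≈ᵥ⇒within : ∀ {v w} → v ≈ᵥ w → Within 0# v w
  ≈ᵥ⇒within v≈w = pointwise λ n →
    ≤-reflexive (trans (v≈w n) (sym (+-identityʳ _))) ,
    ≤-reflexive (trans (sym (v≈w n)) (sym (+-identityʳ _)))

  within⇒≈ᵥ : ∀ {v w} → Within 0# v w → v ≈ᵥ w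
  within⇒≈ᵥ (pointwise h) n = antisym (≤-trans (proj₁ (h n)) (≤-reflexive (+-identityʳ _)))
                          (≤-trans (proj₂ (h n)) (≤-reflexive (+-identityʳ _)))

  ≡⇒≈ᵥ : ∀ {v w} → v ≡ w → v ≈ᵥ w
  ≡⇒≈ᵥ ≡.refl n = refl

  ≈ᵥ⇒𝔡< : ∀ {e v w} → 0# < e → v ≈ᵥ w → 𝔡 v w < e
  ≈ᵥ⇒𝔡< {e} {v} {w} 0<e v≈w = begin-strict
    𝔡 v w ≤⟨ within⇒𝔡≤ {v = v} {w} (≈ᵥ⇒within v≈w) ⟩
    0#    <⟨ 0<e ⟩
    e     ∎

  within-𝔡 : ∀ v w → Within (𝔡 v w) v w
  within-𝔡 v w = 𝔡≤⇒within ≤-refl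

  𝔡-sym : ∀ v w → 𝔡 v w ≤ 𝔡 w v
  𝔡-sym v w = within⇒𝔡≤ (within-sym (within-𝔡 w v))

  𝔡-cong : ∀ {u u′ v v′} → u ≈ᵥ u′ → v ≈ᵥ v′ → 𝔡 u v ≤ 𝔡 u′ v′
  𝔡-cong {u} {u′} {v} {v′} u≈u′ v≈v′ = begin
    𝔡 u v               ≤⟨ within⇒𝔡≤ (within-trans (within-trans (≈ᵥ⇒within {u} {u′} u≈u′)
                             (within-𝔡 u′ v′)) (within-sym (≈ᵥ⇒within {v} {v′} v≈v′))) ⟩
    0# + 𝔡 u′ v′ + 0#   ≈⟨ +-identityʳ (0# + 𝔡 u′ v′) ⟩
    0# + 𝔡 u′ v′        ≈⟨ +-identityˡ (𝔡 u′ v′) ⟩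
    𝔡 u′ v′             ∎

  𝔡-triangle : ∀ u v w → 𝔡 u w ≤ (𝔡 u v + 𝔡 v w)
  𝔡-triangle u v w = within⇒𝔡≤ (within-trans (within-𝔡 u v) (within-𝔡 v w))

  𝔡-path : ∀ s t u v w x y {d₁ d₂ d₃ d₄ d₅ d₆} → 𝔡 s t ≤ d₁ → 𝔡 t u ≤ d₂ → 𝔡 u v ≤ d₃ →
           𝔡 v w ≤ d₄ → 𝔡 w x ≤ d₅ → 𝔡 x y ≤ d₆ →
           𝔡 s y ≤ (d₁ + (d₂ + (d₃ + (d₄ + (d₅ + d₆)))))
  𝔡-path s t u v w x y p₁ p₂ p₃ p₄ p₅ p₆ =
    ≤-trans (𝔡-triangle s t y) (+-mono₂ p₁
    (≤-trans (𝔡-triangle t u y) (+-mono₂ p₂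
    (≤-trans (𝔡-triangle u v y) (+-mono₂ p₃
    (≤-trans (𝔡-triangle v w y) (+-mono₂ p₄
    (≤-trans (𝔡-triangle w x y) (+-mono₂ p₅ p₆)))))))))

  -- A connective is a function on the raw carrier, and it respects `≈ᵥ` by continuity: arguments at
  -- distance zero are closer than every `δ`, so the values are within every `e`.
  continuous⇒cong : ∀ {n} {u : (Fin n → 𝔙) → 𝔙} → Continuous u →
                    ∀ {v w} → (∀ i → v i ≈ᵥ w i) → u v ≈ᵥ u w
  continuous⇒cong {u = u} cont {v} {w} v≈w = within⇒≈ᵥ {u v} {u w} (𝔡≤⇒within (≤-approx λ e 0<e →
    let δ , 0<δ , close = cont v e 0<e in
    ≤-trans (close w λ i → ≈ᵥ⇒𝔡< {v = v i} {w i} 0<δ (v≈w i)) (≤-reflexive (sym (+-identityˡ e)))))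

  -- The maximum metric on 𝔙ⁿ. The starting value `0#` covers `n = 0` and makes nonnegativity
  -- immediate.
  𝔡ⁿ : ∀ {n} → (Fin n → 𝔙) → (Fin n → 𝔙) → ℝ
  𝔡ⁿ v w = ListExtrema.max totalOrder 0# (tabulate λ i → 𝔡 (v i) (w i))

  0≤𝔡ⁿ : ∀ {n} (v w : Fin n → 𝔙) → 0# ≤ 𝔡ⁿ v w
  0≤𝔡ⁿ v w = ListExtrema.⊥≤max totalOrder 0# (tabulate λ i → 𝔡 (v i) (w i))

  𝔡≤𝔡ⁿ : ∀ {n} (v w : Fin n → 𝔙) i → 𝔡 (v i) (w i) ≤ 𝔡ⁿ v w
  𝔡≤𝔡ⁿ v w = tabulate⁻ (ListExtrema.xs≤max totalOrder 0# (tabulate λ i → 𝔡 (v i) (w i)))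

  𝔡ⁿ≤ : ∀ {n e} {v w : Fin n → 𝔙} → 0# ≤ e → (∀ i → 𝔡 (v i) (w i) ≤ e) → 𝔡ⁿ v w ≤ e
  𝔡ⁿ≤ 0≤e h = ListExtrema.max≤v⁺ totalOrder 0≤e (tabulate⁺ h)

  𝔡ⁿ-lipschitz : ∀ {n d} {v v′ : Fin n → 𝔙} w → 0# ≤ d → (∀ i → 𝔡 (v i) (v′ i) ≤ d) →
                 𝔡ⁿ v w ≤ (𝔡ⁿ v′ w + d)
  𝔡ⁿ-lipschitz {d = d} {v} {v′} w 0≤d h = 𝔡ⁿ≤ {v = v} {w} 0≤bound λ i → begin
    𝔡 (v i) (w i)                     ≤⟨ 𝔡-triangle (v i) (v′ i) (w i) ⟩
    𝔡 (v i) (v′ i) + 𝔡 (v′ i) (w i)   ≤⟨ +-mono₂ (h i) (𝔡≤𝔡ⁿ v′ w i) ⟩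
    d + 𝔡ⁿ v′ w                       ≈⟨ +-comm d (𝔡ⁿ v′ w) ⟩
    𝔡ⁿ v′ w + d                       ∎
    where
    0≤bound : 0# ≤ (𝔡ⁿ v′ w + d)
    0≤bound = ≤-trans (0≤𝔡ⁿ v′ w) (r≤r+s (𝔡ⁿ v′ w) 0≤d)

  module IsometricCopyProperties (copy : IsometricCopy) where
    open IsometricCopy copy

    ι-within : ∀ {r s e} → ∣ r - s ∣ ≤ e → 𝔡 (ι r) (ι s) ≤ e
    ι-within {r} {s} p = ≤-trans (≤-reflexive (isometry r s)) p

    -- Congruence of `ι` comes from the isometry: equal reals have images at distance zero.
    ι-cong : ∀ {r s} → r ≈ s → ι r ≈ᵥ ι s
    ι-cong {r} {s} r≈s = within⇒≈ᵥ {ι r} {ι s} (𝔡≤⇒within (ι-within (∣r-s∣≤t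
      (≤-reflexive (trans r≈s (sym (+-identityʳ _))))
      (≤-reflexive (trans (sym r≈s) (sym (+-identityʳ _)))))))

    ι-injective : ∀ {r s} → ι r ≈ᵥ ι s → r ≈ s
    ι-injective {r} {s} ιr≈ιs = antisym
      (≤-trans (∣r-s∣≤t⇒r≤s+t ≤0) (≤-reflexive (+-identityʳ _)))
      (≤-trans (∣r-s∣≤t⇒s≤r+t ≤0) (≤-reflexive (+-identityʳ _)))
      where
      ≤0 : ∣ r - s ∣ ≤ 0#
      ≤0 = ≤-trans (≤-reflexive (sym (isometry r s))) (within⇒𝔡≤ (≈ᵥ⇒within {ι r} {ι s} ιr≈ιs))

    -- The distance to a fixed tuple is 1-Lipschitz, so `e` serves as its own `δ`. Thus this
    -- distance is an admissible connective for any `w`, with values in the copy of ℝ as the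
    -- quantifiers require.
    ι∘𝔡ⁿ-continuous : ∀ {n} (w : Fin n → 𝔙) → Continuous (λ v → ι (𝔡ⁿ v w))
    ι∘𝔡ⁿ-continuous w v e 0<e = e , 0<e , λ v′ close → ι-within (∣r-s∣≤t
      (𝔡ⁿ-lipschitz {v = v} {v′} w (<⇒≤ 0<e) λ i → <⇒≤ (close i))
      (𝔡ⁿ-lipschitz {v = v′} {v} w (<⇒≤ 0<e) λ i → ≤-trans (𝔡-sym (v′ i) (v i)) (<⇒≤ (close i))))

-- Variable maps between contexts and their action on tuples.

module _ {a} {A : Set a} where

  lift : ∀ {Γ Δ : List A} {s} → All (_∈ Δ) Γ → All (_∈ (s ∷ Δ)) (s ∷ Γ)
  lift ρ = here ≡.refl ∷ All.map there ρ

  idʳ : ∀ (Γ : List A) → All (_∈ Γ) Γ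
  idʳ []      = []
  idʳ (s ∷ Γ) = lift (idʳ Γ)

  left : ∀ (Γ Δ : List A) → All (_∈ (Γ ++ Δ)) Γ
  left []      Δ = []
  left (s ∷ Γ) Δ = lift (left Γ Δ)

  right : ∀ (Γ Δ : List A) → All (_∈ (Γ ++ Δ)) Δ
  right []      Δ = idʳ Δ
  right (s ∷ Γ) Δ = All.map there (right Γ Δ)

module _ {a p} {A : Set a} {P : Pred A p} where

  -- Contravariant in the variable map. When `P` is itself membership in a third context, this is
  -- the composition of variable maps.
  reindex : ∀ {Γ Δ : List A} → All (_∈ Δ) Γ → All P Δ → All P Γ
  reindex ρ a = All.map (All.lookup a) ρ

  reindex-lift : ∀ {Γ Δ s} (ρ : All (_∈ Δ) Γ) (c : P s) (a : All P Δ) →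
                 reindex (lift ρ) (c ∷ a) ≡ c ∷ reindex ρ a
  reindex-lift ρ c a = ≡.cong (c ∷_) (map-∘ ρ)

  reindex-id : ∀ {Γ} (a : All P Γ) → reindex (idʳ Γ) a ≡ a
  reindex-id []      = ≡.refl
  reindex-id (c ∷ a) = ≡.trans (reindex-lift (idʳ _) c a) (≡.cong (c ∷_) (reindex-id a))

  reindex-left : ∀ {Γ Δ} (a : All P Γ) (b : All P Δ) → reindex (left Γ Δ) (++⁺ a b) ≡ a
  reindex-left []      b = ≡.refl
  reindex-left (c ∷ a) b =
    ≡.trans (reindex-lift (left _ _) c (++⁺ a b)) (≡.cong (c ∷_) (reindex-left a b))

  reindex-right : ∀ {Γ Δ} (a : All P Γ) (b : All P Δ) → reindex (right Γ Δ) (++⁺ a b) ≡ b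
  reindex-right []      b = reindex-id b
  reindex-right (c ∷ a) b = ≡.trans (map-∘ (right _ _)) (reindex-right a b)

module _ {a p q} {A : Set a} {P : Pred A p} {Q : Pred A q} where

  map-++⁺ : ∀ (f : P ⊆ Q) {Γ Δ} (a : All P Γ) (b : All P Δ) →
            All.map f (++⁺ a b) ≡ ++⁺ (All.map f a) (All.map f b)
  map-++⁺ f []      b = ≡.refl
  map-++⁺ f (c ∷ a) b = ≡.cong (f c ∷_) (map-++⁺ f a b)

  reindex-map : ∀ (f : P ⊆ Q) {Γ Δ} (ρ : All (_∈ Δ) Γ) (a : All P Δ) →
                reindex ρ (All.map f a) ≡ All.map f (reindex ρ a)
  reindex-map f ρ a = ≡.trans (map-cong ρ (lookup-map a)) (≡.sym (map-∘ ρ))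

-- Each choice sees the list of all earlier ones. As `step` is already a function, recursion on this
-- list suffices. All that is reported about the list is that it contains the earlier terms.
history-choice : ∀ {a p} {A : Set a} (P : List A → A → Set p) → (∀ h → ∃ (P h)) →
                 ∃[ f ] ∀ j → ∃[ h ] P h (f j) × (∀ i → i ℕ.< j → f i ∈ h)
history-choice {A = A} P step =
  f , λ j → history j , proj₂ (step (history j)) , λ i i<j → remembers (≤⇒≤′ i<j)
  where
  history : ℕ → List A
  history zero    = []
  history (suc n) = proj₁ (step (history n)) ∷ history n
  f : ℕ → A
  f n = proj₁ (step (history n))
  -- The order `<′` grows at its upper end, exactly as `history` does.
  remembers : ∀ {i j} → i ℕ.<′ j → f i ∈ history j
  remembers ℕ.≤′-refl       = here ≡.refl
  remembers (ℕ.≤′-step i<j) = there (remembers i<j)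

-- Renaming of variables in terms and formulas.

module LogicProperties {ℓ} (em : ExcludedMiddle ℓ) (R : CompleteOrderedField ℓ)
                       (copy : Values.IsometricCopy em R)
                       (L : Logic.Language em R copy) where
  open CompleteOrderedField R renaming (_≤_ to infix 4 _≤_)
  open Values em R
  open IsometricCopy copy
  open OrderedFieldProperties R
  open ValuesProperties em R
  open IsometricCopyProperties copy
  module 𝓛 = Logic em R copy
  open 𝓛 using (var; app; pred; metr; conn; sup′; inf′)
  open 𝓛.Language L
  open 𝓛.Structure using (∥_∥)

  Structure = 𝓛.Structure L
  Term = 𝓛.Term L
  Formula = 𝓛.Formula L

  K : ∀ {Γ} → Formula Γ → Pred 𝔙 ℓ
  K = 𝓛.K L

  infix 8 _^_
  _^_ : Structure → List Sort → Set ℓ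
  _^_ = 𝓛._^_ L

  eval : ∀ M {Γ} → Formula Γ → M ^ Γ → 𝔙
  eval M = 𝓛.eval L M

  eval₂ : ∀ M {x y} → Formula (x ++ y) → M ^ x → M ^ y → 𝔙
  eval₂ M {x} {y} = 𝓛.eval₂ L M {x} {y}

  rename-term : ∀ {Γ Δ s} → All (_∈ Δ) Γ → Term Γ s → Term Δ s
  rename-terms : ∀ {Γ Δ x} → All (_∈ Δ) Γ → All (Term Γ) x → All (Term Δ) x
  rename-term ρ (var i)    = var (All.lookup ρ i)
  rename-term ρ (app F ts) = app F (rename-terms ρ ts)
  rename-terms ρ []        = []
  rename-terms ρ (t ∷ ts)  = rename-term ρ t ∷ rename-terms ρ ts

  -- Mutual with `K-rename`, because a renamed quantifier needs a new proof that the values of its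
  -- body lie in the copy of ℝ≥0.
  rename : ∀ {Γ Δ} → All (_∈ Δ) Γ → Formula Γ → Formula Δ
  K-rename : ∀ {Γ Δ} (ρ : All (_∈ Δ) Γ) (φ : Formula Γ) → K (rename ρ φ) ⊆ K φ
  rename ρ (pred P ts)   = pred P (rename-terms ρ ts)
  rename ρ (metr t t′)   = metr (rename-term ρ t) (rename-term ρ t′)
  rename ρ (conn u uc φ) = conn u uc (λ i → rename ρ (φ i))
  rename ρ (sup′ s ψ h)  = sup′ s (rename (lift ρ) ψ) (λ k → h (K-rename (lift ρ) ψ k))
  rename ρ (inf′ s ψ h)  = inf′ s (rename (lift ρ) ψ) (λ k → h (K-rename (lift ρ) ψ k))
  K-rename ρ (pred P ts)   k            = k
  K-rename ρ (metr t t′)   k            = k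
  K-rename ρ (conn u uc φ) (w , k , eq) = w , (λ i → K-rename ρ (φ i) (k i)) , eq
  K-rename ρ (sup′ s ψ h)  k            = K-rename (lift ρ) ψ k
  K-rename ρ (inf′ s ψ h)  k            = K-rename (lift ρ) ψ k

  module _ (M : Structure) where
    open 𝓛.Structure M using (func; rel; distance)

    eval-rename-term : ∀ {Γ Δ s} (ρ : All (_∈ Δ) Γ) (t : Term Γ s) (a : M ^ Δ) →
                       𝓛.⟦_⟧ₜ L M (rename-term ρ t) a ≡ 𝓛.⟦_⟧ₜ L M t (reindex ρ a)
    eval-rename-terms : ∀ {Γ Δ x} (ρ : All (_∈ Δ) Γ) (ts : All (Term Γ) x) (a : M ^ Δ) →
                        𝓛.⟦_⟧ₛ L M (rename-terms ρ ts) a ≡ 𝓛.⟦_⟧ₛ L M ts (reindex ρ a)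
    eval-rename-term ρ (var i)    a = ≡.sym (lookup-map ρ i)
    eval-rename-term ρ (app F ts) a = ≡.cong (func F) (eval-rename-terms ρ ts a)
    eval-rename-terms ρ []        a = ≡.refl
    eval-rename-terms ρ (t ∷ ts)  a =
      ≡.cong₂ _∷_ (eval-rename-term ρ t a) (eval-rename-terms ρ ts a)

    -- Stated up to `≈ᵥ`: at a connective the arguments agree only pointwise and continuity takes
    -- over, while at a quantifier the two sets of values have the same elements.
    eval-rename : ∀ {Γ Δ} (ρ : All (_∈ Δ) Γ) (φ : Formula Γ) (a : M ^ Δ) →
                  eval M (rename ρ φ) a ≈ᵥ eval M φ (reindex ρ a)
    eval-rename-lift : ∀ {Γ Δ s} (ρ : All (_∈ Δ) Γ) (ψ : Formula (s ∷ Γ)) c (a : M ^ Δ) →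
                       eval M (rename (lift ρ) ψ) (c ∷ a) ≈ᵥ eval M ψ (c ∷ reindex ρ a)
    eval-rename ρ (pred P ts)   a = ≡⇒≈ᵥ (≡.cong (rel P) (eval-rename-terms ρ ts a))
    eval-rename ρ (metr t t′)   a = ≡⇒≈ᵥ (≡.cong₂ (λ b c → ι (distance b c))
      (eval-rename-term ρ t a) (eval-rename-term ρ t′ a))
    eval-rename ρ (conn u uc φ) a = continuous⇒cong {u = u} uc
      {λ i → eval M (rename ρ (φ i)) a} {λ i → eval M (φ i) (reindex ρ a)}
      λ i → eval-rename ρ (φ i) a
    eval-rename ρ (sup′ s ψ _)  a = ι-cong (sup-cong
      (λ (c , e) → c , λ n → trans (e n) (eval-rename-lift ρ ψ c a n))
      (λ (c , e) → c , λ n → trans (e n) (sym (eval-rename-lift ρ ψ c a n))))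
    eval-rename ρ (inf′ s ψ _)  a = ι-cong (inf-cong
      (λ (c , e) → c , λ n → trans (e n) (eval-rename-lift ρ ψ c a n))
      (λ (c , e) → c , λ n → trans (e n) (sym (eval-rename-lift ρ ψ c a n))))
    eval-rename-lift ρ ψ c a n = trans (eval-rename (lift ρ) ψ (c ∷ a) n)
      (≡⇒≈ᵥ (≡.cong (eval M ψ) (reindex-lift ρ c a)) n)

  -- Quantifiers bind an initial segment of the context; with `y` in front it can be quantified
  -- while `x` supplies parameters.
  swap : ∀ x y → Formula (x ++ y) → Formula (y ++ x)
  swap x y = rename (++⁺ (right y x) (left y x))

  eval-swap : ∀ M {x y} (φ : Formula (x ++ y)) (a : M ^ x) (b : M ^ y) →
              eval₂ M {y} {x} (swap x y φ) b a ≈ᵥ eval₂ M {x} {y} φ a b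
  eval-swap M {x} {y} φ a b n = trans (eval-rename M _ φ (++⁺ b a) n)
    (≡⇒≈ᵥ (≡.cong (eval M φ) (≡.trans (map-++⁺ _ (right y x) (left y x))
      (≡.cong₂ ++⁺ (reindex-right b a) (reindex-left b a)))) n)

  -- The same `h` serves at every stage, since an infimum has the value set of its body. The head of
  -- `y` is bound innermost.
  infᵗ : ∀ y {Γ} (ψ : Formula (y ++ Γ)) → K ψ ⊆ 𝓛.Nonnegative L → Formula Γ
  infᵗ []      ψ h = ψ
  infᵗ (s ∷ y) ψ h = infᵗ y (inf′ s ψ h) h

  -- The real function `r` stands for `ψ`, and the last two clauses make `t` its infimum. In the
  -- induction the innermost quantifier replaces `r` by `r′`, its infimum over the first coordinate.
  eval-infᵗ : ∀ M y {Γ} (ψ : Formula (y ++ Γ)) (h : K ψ ⊆ 𝓛.Nonnegative L) (a : M ^ Γ) (r : M ^ y → ℝ) →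
    (∀ b → 0# ≤ r b) → (∀ b → eval M ψ (++⁺ b a) ≈ᵥ ι (r b)) →
    ∃[ t ] eval M (infᵗ y ψ h) a ≈ᵥ ι t × (∀ b → t ≤ r b) × (∀ {e} → t < e → ∃[ b ] r b < e)
  eval-infᵗ M []      ψ h a r 0≤r ψ≈r = r [] , ψ≈r [] , (λ { [] → ≤-refl }) , λ t<e → [] , t<e
  eval-infᵗ M (s ∷ y) ψ h a r 0≤r ψ≈r =
    let t , ≈t , t≤r′ , approached = eval-infᵗ M y (inf′ s ψ h) h a r′ 0≤r′ (λ b n → refl) in
    t , ≈t , (λ { (c ∷ b) → ≤-trans (t≤r′ b) (r′≤r c b) }) , λ t<e →
      -- The tail `b` comes first, from the induction hypothesis; the head `c` is then chosen for
      -- this `b`.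
      let b , r′b<e = approached t<e
          u , (c , u∈) , u<e = infimum-approached (r′-isInf b) r′b<e
      in c ∷ b , (begin-strict r (c ∷ b) ≈⟨ r≈ c b u∈ ⟨ u <⟨ u<e ⟩ _ ∎)
    where
    S : M ^ y → Pred ℝ ℓ
    S b u = Σ[ c ∈ ∥_∥ M s ] ι u ≈ᵥ eval M ψ (c ∷ ++⁺ b a)
    r′ : M ^ y → ℝ
    r′ b = inf (S b)
    r≈ : ∀ {u} c b → ι u ≈ᵥ eval M ψ (c ∷ ++⁺ b a) → u ≈ r (c ∷ b)
    r≈ c b u∈ = ι-injective λ n → trans (u∈ n) (ψ≈r (c ∷ b) n)
    0-lowerBound : ∀ b → LowerBound (S b) 0#
    0-lowerBound b u (c , u∈) = ≤-trans (0≤r (c ∷ b)) (≤-reflexive (sym (r≈ c b u∈)))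
    -- Sorts are nonempty and the values are nonnegative, so `inf` is a genuine infimum.
    r′-isInf : ∀ b → IsInf (S b) (r′ b)
    r′-isInf b = infimum (S b) (r (c ∷ b) , c , λ n → sym (ψ≈r (c ∷ b) n)) (0# , 0-lowerBound b)
      where c = CompleteMetricSpace.point (𝓛.Structure.sort M s)
    0≤r′ : ∀ b → 0# ≤ r′ b
    0≤r′ b = proj₂ (r′-isInf b) 0# (0-lowerBound b)
    r′≤r : ∀ c b → r′ b ≤ r (c ∷ b)
    r′≤r c b = proj₁ (r′-isInf b) (r (c ∷ b)) (c , λ n → sym (ψ≈r (c ∷ b) n))

  -- A connective needs its arguments in one common context. The parameter tuples are concatenated,
  -- and `π i` recovers the one of the formula with index `i`.
  merge : ∀ M {n} (Δ : Fin n → List Sort) (p : ∀ i → M ^ Δ i) →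
          Σ[ Δ′ ∈ List Sort ] Σ[ p′ ∈ M ^ Δ′ ] Σ[ π ∈ (∀ i → All (_∈ Δ′) (Δ i)) ]
          ∀ i → reindex (π i) p′ ≡ p i
  merge M {zero}  Δ p = [] , [] , (λ ()) , λ ()
  merge M {suc n} Δ p =
    let Δ′ , p′ , π , π-p′ = merge M (Δ ∘ suc) (p ∘ suc) in
    Δ zero ++ Δ′ , ++⁺ (p zero) p′ ,
    (λ { zero → left (Δ zero) Δ′ ; (suc i) → reindex (π i) (right (Δ zero) Δ′) }) ,
    λ { zero    → reindex-left (p zero) p′
      ; (suc i) → ≡.trans (≡.sym (reindex-map _ (π i) (right (Δ zero) Δ′)))
                    (≡.trans (≡.cong (reindex (π i)) (reindex-right (p zero) p′)) (π-p′ i)) }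

  -- Approximating elements of `N` by elements of `M`.

  module _ {M N : Structure} (N⪰M : 𝓛._⪰_ L N M) where
    open 𝓛._⪰_ N⪰M

    -- The infimum over y of the distance between (θᵢ(y))ᵢ and the fixed value (θᵢ(b))ᵢ is zero in N,
    -- hence zero in M.
    approximate : ∀ y {n} (Δ : Fin n → List Sort) (θ : ∀ i → Formula (y ++ Δ i))
      (p : ∀ i → M ^ Δ i) (b : N ^ y) {e} → 0# < e →
      Σ[ b′ ∈ M ^ y ] ∀ i → 𝔡 (eval₂ M (θ i) b′ (p i)) (eval₂ N (θ i) b (incl (p i))) < e
    approximate y {n} Δ θ p b {e} 0<e = b′ , λ i → begin-strict
        𝔡 (eval₂ M (θ i) b′ (p i)) (w i)
          ≤⟨ 𝔡-cong {eval₂ M (θ i) b′ (p i)} {eval₂ M (θ′ i) b′ p′} {w i} {w i}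
               (λ m → sym (eval-θ′ M i b′ p′ (π-p′ i) m)) (λ _ → refl) ⟩
        𝔡 (eval₂ M (θ′ i) b′ p′) (w i)
          ≤⟨ 𝔡≤𝔡ⁿ (λ i → eval₂ M (θ′ i) b′ p′) w i ⟩
        distance M b′ p′
          <⟨ proj₂ nearby ⟩
        e ∎
      where
      w : Fin n → 𝔙
      w i = eval₂ N (θ i) b (incl (p i))
      merged = merge M Δ p
      Δ′ = proj₁ merged
      p′ = proj₁ (proj₂ merged)
      π = proj₁ (proj₂ (proj₂ merged))
      π-p′ = proj₂ (proj₂ (proj₂ merged))

      θ′ : Fin n → Formula (y ++ Δ′)
      θ′ i = rename (++⁺ (left y Δ′) (reindex (π i) (right y Δ′))) (θ i)

      eval-θ′ : ∀ M i (b : M ^ y) (p′ : M ^ Δ′) {p} → reindex (π i) p′ ≡ p →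
                eval₂ M (θ′ i) b p′ ≈ᵥ eval₂ M (θ i) b p
      eval-θ′ M i b p′ ≡.refl m = trans (eval-rename M _ (θ i) (++⁺ b p′) m)
        (≡⇒≈ᵥ (≡.cong (eval M (θ i)) (≡.trans (map-++⁺ _ (left y Δ′) _)
          (≡.cong₂ ++⁺ (reindex-left b p′)
            (≡.trans (≡.sym (reindex-map _ (π i) (right y Δ′)))
              (≡.cong (reindex (π i)) (reindex-right b p′)))))) m)

      distance : ∀ M → M ^ y → M ^ Δ′ → ℝ
      distance M b p′ = 𝔡ⁿ (λ i → eval₂ M (θ′ i) b p′) w

      -- The target `w`, computed in `N`, enters through the connective and not as a parameter. The
      -- parameters of `χ` therefore all lie in `M`, and elementarity applies to its infimum.
      χ : Formula (y ++ Δ′)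
      χ = conn (λ v → ι (𝔡ⁿ v w)) (ι∘𝔡ⁿ-continuous w) θ′

      χ-nonneg : K χ ⊆ 𝓛.Nonnegative L
      χ-nonneg (v , _ , eq) = 𝔡ⁿ v w , 0≤𝔡ⁿ v w , eq

      eval-infχ : ∀ M (p′ : M ^ Δ′) → _
      eval-infχ M p′ = eval-infᵗ M y χ (λ {v} → χ-nonneg {v}) p′ (λ b → distance M b p′)
        (λ b → 0≤𝔡ⁿ (λ i → eval₂ M (θ′ i) b p′) w) (λ _ _ → refl)

      infM = eval-infχ M p′
      infN = eval-infχ N (incl p′)

      distance-b≤0 : distance N b (incl p′) ≤ 0#
      distance-b≤0 = 𝔡ⁿ≤ {v = λ i → eval₂ N (θ′ i) b (incl p′)} {w} ≤-refl λ i → within⇒𝔡≤ (≈ᵥ⇒within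
        {eval₂ N (θ′ i) b (incl p′)} {w i} (eval-θ′ N i b (incl p′)
          (≡.trans (reindex-map _ (π i) p′) (≡.cong incl (π-p′ i)))))

      infM<e : proj₁ infM < e
      infM<e = begin-strict
        -- Elementarity equates the two infima as elements of 𝔙; injectivity of `ι` equates them as
        -- reals.
        proj₁ infM             ≈⟨ ι-injective (λ m → trans (sym (proj₁ (proj₂ infM) m))
                                    (trans (elementary (infᵗ y χ (λ {v} → χ-nonneg {v})) p′ m)
                                      (proj₁ (proj₂ infN) m))) ⟩
        proj₁ infN             ≤⟨ proj₁ (proj₂ (proj₂ infN)) b ⟩
        distance N b (incl p′) ≤⟨ distance-b≤0 ⟩
        0#                     <⟨ 0<e ⟩
        e                      ∎

      nearby : ∃[ b′ ] distance M b′ p′ < e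
      nearby = proj₂ (proj₂ (proj₂ infM)) infM<e
      b′ = proj₁ nearby

    incl-++⁺ : ∀ {x y} (φ : Formula (x ++ y)) (a : M ^ x) (b : M ^ y) →
               eval₂ M {x} {y} φ a b ≈ᵥ eval₂ N {x} {y} φ (incl a) (incl b)
    incl-++⁺ φ a b n = trans (elementary φ (++⁺ a b) n)
      (≡⇒≈ᵥ (≡.cong (eval N φ) (map-++⁺ emb a b)) n)

    -- The two sequences and the contradiction with stability.

    module _ (x y z : List Sort) (φ : Formula (x ++ y)) (q : 𝓛.TypeOver L N {x} {y} φ)
             (fs : 𝓛.FinitelySatisfiable L N⪰M {x} {y} φ q)
             (ψ : Formula (y ++ z)) (c : M ^ z) (b* : N ^ y) where
      open 𝓛.TypeOver q using (value)

      φᴹ : M ^ x → M ^ y → 𝔙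
      φᴹ = eval₂ M {x} {y} φ

      φᴺ : M ^ x → N ^ y → 𝔙
      φᴺ a = eval₂ N {x} {y} φ (incl a)

      ψᴹ : M ^ y → 𝔙
      ψᴹ b = eval₂ M {y} {z} ψ b c

      ψᴺ : 𝔙
      ψᴺ = eval₂ N {y} {z} ψ b* (incl c)

      -- The fields tie the new pair to the earlier pairs and to `b*`, never its two components to
      -- each other, so `next` can choose these independently.
      record Next (η : ℝ) (h : List (M ^ x × M ^ y)) (new : M ^ x × M ^ y) : Set ℓ where
        field
          a-old : ∀ {a b} → (a , b) ∈ h → 𝔡 (φᴺ (proj₁ new) (incl b)) (value (incl b)) < η
          a-b*  : 𝔡 (φᴺ (proj₁ new) b*) (value b*) < η
          b-old : ∀ {a b} → (a , b) ∈ h → 𝔡 (φᴹ a (proj₂ new)) (φᴺ a b*) < η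
          b-ψ   : 𝔡 (ψᴹ (proj₂ new)) ψᴺ < η

      next : ∀ {η} → 0# < η → ∀ h → ∃ (Next η h)
      next {η} 0<η h = (a′ , b′) , record
        { a-old = λ m → ≡.subst (λ (_ , b) → 𝔡 (φᴺ a′ (incl b)) (value (incl b)) < η)
            (≡.sym (lookup-index m)) (proj₂ a′-spec (suc (Any.index m)))
        ; a-b*  = proj₂ a′-spec zero
        ; b-old = λ m → ≡.subst (λ (a , _) → 𝔡 (φᴹ a b′) (φᴺ a b*) < η)
            (≡.sym (lookup-index m)) (b′-φ (Any.index m))
        ; b-ψ   = proj₂ b′-spec zero
        }
        where
        n = length h
        old : Fin n → M ^ x × M ^ y
        old = List.lookup h

        -- One use of finite satisfiability treats `b*`, at index `zero`, together with all earlier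
        -- `b`.
        bs : Fin (suc n) → N ^ y
        bs zero    = b*
        bs (suc i) = incl (proj₂ (old i))

        a′-spec = fs (suc n) bs η 0<η
        a′ = proj₁ a′-spec

        -- Index `zero` belongs to `ψ` with parameters `c`, the others to `φ` with an earlier `a` as
        -- parameter, so the parameter contexts differ.
        Δ : Fin (suc n) → List Sort
        Δ zero    = z
        Δ (suc i) = x

        θ : ∀ i → Formula (y ++ Δ i)
        θ zero    = ψ
        θ (suc i) = swap x y φ

        p : ∀ i → M ^ Δ i
        p zero    = c
        p (suc i) = proj₁ (old i)

        b′-spec = approximate y Δ θ p b* 0<η
        b′ = proj₁ b′-spec

        b′-φ : ∀ i → 𝔡 (φᴹ (proj₁ (old i)) b′) (φᴺ (proj₁ (old i)) b*) < η
        b′-φ i = begin-strict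
          𝔡 (φᴹ a b′) (φᴺ a b*)
            ≤⟨ 𝔡-cong {φᴹ a b′} {φˢ M b′ a} {φᴺ a b*} {φˢ N b* (incl a)}
                 (λ m → sym (eval-swap M {x} {y} φ a b′ m))
                 (λ m → sym (eval-swap N {x} {y} φ (incl a) b* m)) ⟩
          𝔡 (φˢ M b′ a) (φˢ N b* (incl a))
            <⟨ proj₂ b′-spec (suc i) ⟩
          η ∎
          where
          a = proj₁ (old i)
          φˢ : ∀ M → M ^ y → M ^ x → 𝔙
          φˢ M = eval₂ M {y} {x} (swap x y φ)

      -- Here `(a , b)` is the earlier pair and `(a′ , b′)` the later one. The first and last steps
      -- of the path come from the choice of the earlier pair, the second and fourth from that of
      -- the later; the third is the assumed failure of separation by `ε`.
      chain : ∀ {ε δ η γ a b a′ b′ h h′} → ((η + η) + (η + η)) ≈ γ → 𝔡 (value (incl b)) (ψᴹ b) ≤ δ →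
              𝔡 (φᴹ a b′) (φᴹ a′ b) ≤ ε → Next η h (a , b) → Next η h′ (a′ , b′) → (a , b) ∈ h′ →
              𝔡 (value b*) ψᴺ ≤ ((δ + ε) + γ)
      chain {ε} {δ} {η} {γ} {a} {b} {a′} {b′} 4η≈γ ≤δ ≤ε i j m = begin
        𝔡 (value b*) ψᴺ
          ≤⟨ 𝔡-path (value b*) (φᴺ a b*) (φᴹ a b′) (φᴹ a′ b) (value (incl b)) (ψᴹ b) ψᴺ
               (≤-trans (𝔡-sym (value b*) (φᴺ a b*)) (<⇒≤ (Next.a-b* i)))
               (≤-trans (𝔡-sym (φᴺ a b*) (φᴹ a b′)) (<⇒≤ (Next.b-old j m)))
               ≤ε a′-value ≤δ (<⇒≤ (Next.b-ψ i)) ⟩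
        η + (η + (ε + (η + (δ + η))))         ≈⟨ six-term-sum η ε δ ⟩
        (δ + ε) + ((η + η) + (η + η))         ≈⟨ +-congˡ 4η≈γ ⟩
        (δ + ε) + γ                           ∎
        where
        a′-value : 𝔡 (φᴹ a′ b) (value (incl b)) ≤ η
        a′-value = ≤-trans
          (𝔡-cong {φᴹ a′ b} {φᴺ a′ (incl b)} {value (incl b)} {value (incl b)}
            (incl-++⁺ {x} {y} φ a′ b) (λ _ → refl))
          (<⇒≤ (Next.a-old j m))

      -- If the separation fell below `ε` for some `i < j`, `chain` would contradict `far`; so the
      -- two sequences violate stability.
      no-approximants : ∀ {ε δ η γ} → 𝓛.Stable L ε M {x} {y} φ →
        (∀ b → 𝔡 (value (incl b)) (ψᴹ b) ≤ δ) → ((η + η) + (η + η)) ≈ γ →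
        ((δ + ε) + γ) < 𝔡 (value b*) ψᴺ →
        ¬ (∃[ f ] ∀ j → ∃[ h ] Next η h (f j) × (∀ i → i ℕ.< j → f i ∈ h))
      no-approximants {ε} {δ} {η} stable close 4η≈γ far (f , spec) = stable (a , b , unstable)
        where
        a : ℕ → M ^ x
        a = proj₁ ∘ f
        b : ℕ → M ^ y
        b = proj₂ ∘ f
        unstable : ∀ i j → i ℕ.< j → ε ≤ 𝔡 (φᴹ (a i) (b j)) (φᴹ (a j) (b i))
        unstable i j i<j = ≤-stable λ d<ε → <⇒≱ far
          (chain {ε} {δ} {η} {a = a i} {b i} {a j} {b j} 4η≈γ (close (b i)) (<⇒≤ d<ε)
            (proj₁ (proj₂ (spec i))) (proj₁ (proj₂ (spec j))) (proj₂ (proj₂ (spec j)) i i<j))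

      value-ψ : ∀ {ε δ} → 𝓛.Stable L ε M {x} {y} φ → (∀ b → 𝔡 (value (incl b)) (ψᴹ b) ≤ δ) →
                𝔡 (value b*) ψᴺ ≤ (δ + ε)
      value-ψ stable close = ≤-approx λ γ 0<γ →
        -- Halving twice makes `η` a quarter of `γ`, since the path in `chain` has four steps of
        -- length `η`.
        let γ′ , 0<γ′ , 2γ′≈γ = halve γ 0<γ
            η , 0<η , 2η≈γ′ = halve γ′ 0<γ′
        in ≤-stable λ far →
          no-approximants stable close (trans (+-cong 2η≈γ′ 2η≈γ′) 2γ′≈γ) far
            (history-choice (Next η) (next 0<η))

lemma3p9 : ∀ {ℓ} (em : ExcludedMiddle ℓ) (R : CompleteOrderedField ℓ)
    (copy : Values.IsometricCopy em R) →
    let open CompleteOrderedField R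
        open Values em R
        open Logic em R copy
    in
    (L : Language) (M N : Structure L) (N⪰M : _⪰_ L N M) →
    let open _⪰_ N⪰M in
    (x y : List (Language.Sort L)) (φ : Formula L (x ++ y))
    (q : TypeOver L N {x} {y} φ) → FinitelySatisfiable L N⪰M {x} {y} φ q →
    (ε δ : ℝ) → 0# < ε → 0# ≤ δ →
    Stable L ε M {x} {y} φ →
    (z : List (Language.Sort L)) (ψ : Formula L (y ++ z)) (c : _^_ L M z) →
    ((b : _^_ L M y) → 𝔡 (TypeOver.value q (incl b)) (eval₂ L M {y} {z} ψ b c) ≤ δ) →
    (b : _^_ L N y) → 𝔡 (TypeOver.value q b) (eval₂ L N {y} {z} ψ b (incl c)) ≤ (δ + ε)
lemma3p9 em R copy L M N N⪰M x y φ q fs ε δ 0<ε 0≤δ stable z ψ c close b =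
  LogicProperties.value-ψ em R copy L N⪰M x y z φ q fs ψ c b stable close
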